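{- Let $G$ be a graph on $n$ vertices of tree-width $w$, and suppose that its complement $\overline{G}$ is closed under the Bondy–Chvátal closure, i.e. for every two distinct vertices $u,v$ that are non-adjacent in $\overline{G}$ we have $\deg_{\overline{G}}(u)+\deg_{\overline{G}}(v)<n$. Then the neighborhood diversity of $\overline{G}$ is at most $2^{k}+k$, where $k=2(w^2+w)$.
   Context: All graphs are finite and simple. The complement $\overline{G}$ of a graph $G=(V,E)$ is the graph $(V,\binom{V}{2}\setminus E)$. Tree-width: a tree decomposition of $G$ is a pair $(T,\{X_i\}_{i\in I})$ with $T=(I,F)$ a tree and bags $X_i\subseteq V(G)$ such that every vertex lies in some bag, every edge has both endpoints in some bag, and for each vertex $v$ the nodes whose bags contain $v$ induce a subtree of $T$; its width is $\max_i|X_i|-1$, and the tree-width of $G$ is the minimum width over all tree decompositions. The neighborhood diversity of a graph $H$ is the minimum size of a partition of $V(H)$ into classes such that any two vertices $v,v'$ in the same class satisfy $N(v)\setminus\{v'\}=N(v')\setminus\{v\}$. -}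

module Defs where

open import Data.Empty using (⊥)
open import Data.Fin.Base using (Fin)
open import Data.Fin.Properties using (_≟_)
open import Data.Fin.Subset using (Subset; _∈_; ∣_∣; _-_)
open import Data.List.Base using (List; []; _∷_; _∷ʳ_; length)
open import Data.List.Relation.Unary.Linked using (Linked)
open import Data.List.Relation.Unary.Unique.Propositional using (Unique)
open import Data.Nat.Base using (ℕ; _+_; _∸_; _⊔_; _≤_; _<_)
open import Data.Product.Base using (Σ; ∃; ∃-syntax; _×_; _,_; proj₁)
open import Data.Vec.Base using (tabulate)
open import Data.Vec.Functional using (foldr)
open import Function.Definitions using (StrictlySurjective)
open import Level using (Level; 0ℓ)
open import Relation.Binary.Core using (Rel)
open import Relation.Binary.Definitions using (Decidable; Irreflexive; Symmetric)
open import Relation.Binary.Construct.Closure.ReflexiveTransitive using (Star)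
open import Relation.Binary.PropositionalEquality using (_≡_; _≢_; sym; cong)
open import Relation.Nullary using (¬_; ⌊_⌋)
open import Relation.Nullary.Decidable using (¬?; _×-dec_)

private
  variable
    ℓ : Level
    n : ℕ
    V : Set

record Graph (V : Set) : Set₁ where
  field
    Adj       : Rel V 0ℓ
    adj?      : Decidable Adj
    symmetric : Symmetric Adj
    loopless  : Irreflexive _≡_ Adj

open Graph public

complement : Graph (Fin n) → Graph (Fin n)
complement G = record
  { Adj       = λ u v → u ≢ v × ¬ Adj G u v
  ; adj?      = λ u v → ¬? (u ≟ v) ×-dec ¬? (adj? G u v)
  ; symmetric = λ (u≢v , ¬uv) → (λ v≡u → u≢v (sym v≡u)) , (λ vu → ¬uv (symmetric G vu))
  ; loopless  = λ u≡v (u≢v , _) → u≢v u≡v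
  }

induced : Graph V → (P : V → Set) → Graph (Σ V P)
induced G P = record
  { Adj       = λ (u , _) (v , _) → Adj G u v
  ; adj?      = λ (u , _) (v , _) → adj? G u v
  ; symmetric = symmetric G
  ; loopless  = λ u≡v → loopless G (cong proj₁ u≡v)
  }

neighbours : Graph (Fin n) → Fin n → Subset n
neighbours G v = tabulate λ u → ⌊ adj? G v u ⌋

degree : Graph (Fin n) → Fin n → ℕ
degree G v = ∣ neighbours G v ∣

BondyChvátalClosed : Graph (Fin n) → Set
BondyChvátalClosed {n} G =
  ∀ u v → u ≢ v → ¬ Adj G u v → degree G u + degree G v < n

-- The first vertex is repeated at the end of the linked list to close the walk.
IsCycle : Graph V → List V → Set
IsCycle G []       = ⊥
IsCycle G (x ∷ xs) =
  3 ≤ length (x ∷ xs) × Unique (x ∷ xs) × Linked (Adj G) (x ∷ (xs ∷ʳ x))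

record IsTree (G : Graph V) : Set where
  field
    nonempty  : V
    connected : ∀ u v → Star (Adj G) u v
    acyclic   : ∀ xs → ¬ IsCycle G xs

record TreeDecomposition (G : Graph (Fin n)) : Set₁ where
  field
    size          : ℕ
    tree          : Graph (Fin size)
    isTree        : IsTree tree
    bag           : Fin size → Subset n
    coversVertex  : ∀ v → ∃[ i ] v ∈ bag i
    coversEdge    : ∀ {u v} → Adj G u v → ∃[ i ] (u ∈ bag i × v ∈ bag i)
    bagsOfSubtree : ∀ v → IsTree (induced tree (λ i → v ∈ bag i))

  -- Truncated subtraction differs from subtraction only when every bag is
  -- empty, so only the graph without vertices is affected: its tree-width
  -- is 0 here rather than -1.
  width : ℕ
  width = foldr _⊔_ 0 (λ i → ∣ bag i ∣) ∸ 1

open TreeDecomposition public using (width)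

IsMinimum : (ℕ → Set ℓ) → ℕ → Set ℓ
IsMinimum P m = P m × (∀ j → P j → m ≤ j)

HasTreeWidth : Graph (Fin n) → ℕ → Set₁
HasTreeWidth G = IsMinimum λ w → ∃ λ (D : TreeDecomposition G) → width D ≡ w

-- A partition into m classes is a map onto Fin m; surjectivity makes every
-- class nonempty.
record TypePartition (H : Graph (Fin n)) (m : ℕ) : Set where
  field
    class      : Fin n → Fin m
    surjective : StrictlySurjective _≡_ class
    sameType   : ∀ v v′ → class v ≡ class v′ →
                 neighbours H v - v′ ≡ neighbours H v′ - v

HasNeighbourhoodDiversity : Graph (Fin n) → ℕ → Set
HasNeighbourhoodDiversity H = IsMinimum (TypePartition H)

{-# OPTIONS --safe #-}

-- Root the tree of the decomposition and let top v be the node nearest to the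
-- root among the nodes whose bags contain v. Two intersecting subtrees have one
-- top inside the other, so every edge uv has u ∈ bag (top v) or v ∈ bag (top u);
-- hence the degrees of G sum to at most 2wn. Closedness says that
-- deg u + deg v ≥ n − 1 for every edge uv of G, so the set S of vertices with
-- 2 deg v ≥ n − 1 is a vertex cover, and |S| (n − 1) ≤ 4wn. Thus either
-- n ≤ 4w + 1, or |S| ≤ 4w ≤ k; in the latter case a vertex outside S is
-- determined up to twins by its neighbourhood in S, which gives at most
-- 2^|S| + |S| classes.
module Submission where

open import Defs
import Algebra.Properties.CommutativeMonoid.Sum
open import Data.Bool.Base using (Bool; true; false; if_then_else_)
open import Data.Bool.Properties using () renaming (_≟_ to _≟ᵇ_)
open import Data.Empty using (⊥-elim)
open import Data.Fin.Base using (Fin; zero; suc; join; splitAt; funToFin; finToFun)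
open import Data.Fin.Properties using (_≟_; any?; injective⇒≤; finToFun-funToFin; splitAt-join)
open import Data.Fin.Subset
  using (Subset; inside; outside; _∈_; _∉_; _⊆_; _∪_; _-_; ∣_∣; ⊤; ⁅_⁆)
open import Data.Fin.Subset.Properties
  using (_∈?_; ⊆-antisym; p⊆q⇒∣p∣≤∣q∣; p─q⊆p; x∈p∪q⁺; x∈p∧x≢y⇒x∈p-y;
         x∈p⇒∣p-x∣<∣p∣; x∈⁅x⁆; ∣⁅x⁆∣≡1; ∣⊤∣≡n)
open import Data.List.Base using (List; []; _∷_; _++_; _∷ʳ_; head)
open import Data.List.Membership.Propositional using () renaming (_∈_ to _∈ₗ_)
open import Data.List.Membership.Propositional.Properties using (∈-∃++; ∈-++⁺ʳ)
import Data.List.Properties as List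
open import Data.List.Relation.Unary.All as All using (All; []; _∷_)
open import Data.List.Relation.Unary.All.Properties as All using (¬Any⇒All¬)
open import Data.List.Relation.Unary.AllPairs using ([]; _∷_)
open import Data.List.Relation.Unary.Any using (here; there)
open import Data.List.Relation.Unary.Linked using (Linked; [-]; _∷_)
open import Data.List.Relation.Unary.Unique.Propositional using (Unique)
open import Data.Maybe.Base using (just)
open import Data.Maybe.Properties using (just-injective)
open import Data.Nat.Base
  using (ℕ; zero; suc; _+_; _*_; _^_; _∸_; _⊔_; _≤_; z≤n; s≤s)
open import Data.Nat.Properties hiding (_≟_)
open import Data.Nat.Tactic.RingSolver using (solve-∀)
open import Data.Product.Base using (Σ; ∃; ∃-syntax; _×_; _,_; proj₁; proj₂)
open import Data.Sum.Base using (_⊎_; inj₁; inj₂)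
open import Data.Sum.Properties using (inj₁-injective; inj₂-injective)
open import Data.Vec.Base as Vec using ([]; _∷_; tabulate)
import Data.Vec.Functional as Vector
open import Data.Vec.Properties
  using (lookup∘tabulate; []=⇒lookup; lookup⇒[]=; ≡-dec)
open import Function.Base using (_∘_; id; flip)
open import Function.Bundles using (_⇔_; mk⇔; Equivalence)
open import Level using (0ℓ)
open import Relation.Binary.Construct.Closure.ReflexiveTransitive using (Star; ε; _◅_)
open import Relation.Binary.Core using (Rel; REL)
import Relation.Binary.Definitions as B
open import Relation.Binary.PropositionalEquality
  using (_≡_; _≢_; refl; sym; trans; cong; subst; module ≡-Reasoning)
open import Relation.Binary.Structures using (IsEquivalence)
open import Relation.Nullary using (¬_; Dec; yes; no; ⌊_⌋; contradiction)
open import Relation.Nullary.Decidable using (dec-true; isYes≗does)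
open import Relation.Unary using (Pred; Decidable)

open Algebra.Properties.CommutativeMonoid.Sum +-0-commutativeMonoid
  using (sum; ∑-comm; ∑-distrib-+; sum-cong-≗)

private
  variable
    m n : ℕ
    V : Set

-- Finite sums and cardinalities

sum-mono : {f g : Fin n → ℕ} → (∀ i → f i ≤ g i) → sum f ≤ sum g
sum-mono {zero}  f≤g = z≤n
sum-mono {suc n} f≤g = +-mono-≤ (f≤g zero) (sum-mono (f≤g ∘ suc))

sum-≤-const : ∀ {c} {f : Fin n → ℕ} → (∀ i → f i ≤ c) → sum f ≤ n * c
sum-≤-const {zero}  f≤c = z≤n
sum-≤-const {suc n} f≤c = +-mono-≤ (f≤c zero) (sum-≤-const (f≤c ∘ suc))

-- A Markov-type bound: the terms outside `p` are dropped.
∣p∣*c≤sum : ∀ {c} (p : Subset n) {f : Fin n → ℕ} →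
            (∀ {i} → i ∈ p → c ≤ f i) → ∣ p ∣ * c ≤ sum f
∣p∣*c≤sum []            c≤f = z≤n
∣p∣*c≤sum (inside  ∷ p) c≤f = +-mono-≤ (c≤f Vec.here) (∣p∣*c≤sum p (c≤f ∘ Vec.there))
∣p∣*c≤sum (outside ∷ p) c≤f = m≤n⇒m≤o+n _ (∣p∣*c≤sum p (c≤f ∘ Vec.there))

∣p∪q∣≤∣p∣+∣q∣ : (p q : Subset n) → ∣ p ∪ q ∣ ≤ ∣ p ∣ + ∣ q ∣
∣p∪q∣≤∣p∣+∣q∣ []            []            = z≤n
∣p∪q∣≤∣p∣+∣q∣ (outside ∷ p) (outside ∷ q) = ∣p∪q∣≤∣p∣+∣q∣ p q
∣p∪q∣≤∣p∣+∣q∣ (outside ∷ p) (inside  ∷ q) =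
  ≤-trans (s≤s (∣p∪q∣≤∣p∣+∣q∣ p q)) (≤-reflexive (sym (+-suc ∣ p ∣ ∣ q ∣)))
∣p∪q∣≤∣p∣+∣q∣ (inside  ∷ p) (outside ∷ q) = s≤s (∣p∪q∣≤∣p∣+∣q∣ p q)
∣p∪q∣≤∣p∣+∣q∣ (inside  ∷ p) (inside  ∷ q) =
  s≤s (≤-trans (∣p∪q∣≤∣p∣+∣q∣ p q) (+-monoʳ-≤ ∣ p ∣ (n≤1+n ∣ q ∣)))

x∉p-x : {p : Subset n} {x : Fin n} → x ∉ p - x
x∉p-x {p = inside  ∷ _} {zero}  ()
x∉p-x {p = outside ∷ _} {zero}  ()
x∉p-x {p = inside  ∷ p} {suc x} (Vec.there x∈) = x∉p-x {p = p} x∈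
x∉p-x {p = outside ∷ p} {suc x} (Vec.there x∈) = x∉p-x {p = p} x∈

enumerate : (p : Subset n) → Fin ∣ p ∣ → Fin n
enumerate (inside  ∷ p) zero    = zero
enumerate (inside  ∷ p) (suc i) = suc (enumerate p i)
enumerate (outside ∷ p) i       = suc (enumerate p i)

index : {p : Subset n} {x : Fin n} → x ∈ p → ∃[ i ] enumerate p i ≡ x
index {p = inside  ∷ p} Vec.here = zero , refl
index {p = inside  ∷ p} (Vec.there x∈p) with i , refl ← index x∈p = suc i , refl
index {p = outside ∷ p} (Vec.there x∈p) with i , refl ← index x∈p = i , refl

module _ {P : Pred (Fin n) 0ℓ} (P? : Decidable P) where

  -- `neighbours H v` is definitionally `⟦ adj? H v ⟧`, so the two membership lemmas below also
  -- serve for neighbourhoods.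
  ⟦_⟧ : Subset n
  ⟦_⟧ = tabulate λ x → ⌊ P? x ⌋

  ∈-⟦⟧⁺ : ∀ {x} → P x → x ∈ ⟦_⟧
  ∈-⟦⟧⁺ {x} px = lookup⇒[]= x _
    (trans (lookup∘tabulate _ x) (trans (isYes≗does (P? x)) (dec-true (P? x) px)))

  ∈-⟦⟧⁻ : ∀ {x} → x ∈ ⟦_⟧ → P x
  ∈-⟦⟧⁻ {x} x∈ with P? x | trans (sym (lookup∘tabulate (λ y → ⌊ P? y ⌋) x)) ([]=⇒lookup x∈)
  ... | yes px | _ = px
  ... | no  _  | ()

indicator : Bool → ℕ
indicator b = if b then 1 else 0

∣tabulate∣ : (f : Fin n → Bool) → ∣ tabulate f ∣ ≡ sum (indicator ∘ f)
∣tabulate∣ {zero}  f = refl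
∣tabulate∣ {suc n} f with f zero
... | true  = cong suc (∣tabulate∣ (f ∘ suc))
... | false = ∣tabulate∣ (f ∘ suc)

-- Both sides add up the incidence matrix of `R`, by rows and by columns.
double-count : {R : REL (Fin m) (Fin n) 0ℓ} (R? : B.Decidable R) →
               sum (λ i → ∣ ⟦ R? i ⟧ ∣) ≡ sum (λ j → ∣ ⟦ flip R? j ⟧ ∣)
double-count R? = begin
  sum (λ i → ∣ ⟦ R? i ⟧ ∣)                          ≡⟨ sum-cong-≗ (λ i → ∣tabulate∣ (λ j → ⌊ R? i j ⌋)) ⟩
  sum (λ i → sum (λ j → indicator ⌊ R? i j ⌋))      ≡⟨ ∑-comm (λ i j → indicator ⌊ R? i j ⌋) ⟩
  sum (λ j → sum (λ i → indicator ⌊ R? i j ⌋))      ≡⟨ sum-cong-≗ (λ j → ∣tabulate∣ (λ i → ⌊ R? i j ⌋)) ⟨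
  sum (λ j → ∣ ⟦ flip R? j ⟧ ∣)                     ∎
  where open ≡-Reasoning

-- Rooted trees

module _ {T : Graph V} (acyclic : ∀ xs → ¬ IsCycle T xs) where

  -- Trail r x xs: x ∷ xs is a walk from x to r that never turns back along the
  -- edge it has just used.
  data Trail (r : V) : V → List V → Set where
    stop : Trail r r []
    step : ∀ {x y ys} → Adj T x y → head ys ≢ just x → Trail r y ys → Trail r x (y ∷ ys)

  private
    variable
      r x y : V
      xs ys zs : List V

  Trail⇒Linked : ∀ ys → Trail r x (ys ++ y ∷ zs) → Linked (Adj T) (x ∷ (ys ∷ʳ y))
  Trail⇒Linked []       (step x~y _ _)  = x~y ∷ [-]
  Trail⇒Linked (_ ∷ ys) (step x~z _ tr) = x~z ∷ Trail⇒Linked ys tr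

  Unique-++⁻ˡ : ∀ xs → Unique {A = V} (xs ++ ys) → Unique xs
  Unique-++⁻ˡ []       _          = []
  Unique-++⁻ˡ (_ ∷ xs) (x∉ ∷ xs!) = All.++⁻ˡ xs x∉ ∷ Unique-++⁻ˡ xs xs!

  Unique⇒∉prefix : ∀ xs → Unique (xs ++ y ∷ ys) → All (y ≢_) xs
  Unique⇒∉prefix []       _          = []
  Unique⇒∉prefix (_ ∷ xs) (x∉ ∷ xs!) =
    (λ y≡x → All.lookup x∉ (∈-++⁺ʳ xs (here refl)) (sym y≡x)) ∷ Unique⇒∉prefix xs xs!

  -- The part before the return would be a loop, a step back along the edge just used, or a cycle of
  -- length at least 3.
  no-return : ∀ ys → Unique (ys ++ x ∷ zs) → ¬ Trail r x (ys ++ x ∷ zs)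
  no-return []             _  (step x~x _ _)    = loopless T refl x~x
  no-return (_ ∷ [])       _  (step _ nb _)     = nb refl
  no-return (y ∷ z ∷ ys)   u! tr =
    acyclic _ (s≤s (s≤s (s≤s z≤n)) ,
               Unique⇒∉prefix (y ∷ z ∷ ys) u! ∷ Unique-++⁻ˡ (y ∷ z ∷ ys) u! ,
               Trail⇒Linked (y ∷ z ∷ ys) tr)

  -- Once the tail is known to be free of repetitions, a recurrence of `x` in it is excluded by
  -- `no-return`.
  Trail⇒Unique : Trail r x xs → Unique (x ∷ xs)
  Trail⇒Unique stop = [] ∷ []
  Trail⇒Unique tr@(step _ _ tr′) = ¬Any⇒All¬ _ x∉ ∷ Trail⇒Unique tr′
    where
    x∉ : ¬ _ ∈ₗ _
    x∉ x∈ with ys , _ , eq ← ∈-∃++ x∈ =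
      no-return ys (subst Unique eq (Trail⇒Unique tr′)) (subst (Trail _ _) eq tr)

  end∈Trail : Trail r x xs → r ∈ₗ x ∷ xs
  end∈Trail stop          = here refl
  end∈Trail (step _ _ tr) = there (end∈Trail tr)

  Trail-closed : ¬ Trail r r (y ∷ ys)
  Trail-closed tr@(step _ _ tr′) with r∉ ∷ _ ← Trail⇒Unique tr =
    All.lookup r∉ (end∈Trail tr′) refl

  -- Moving x along the first trail shortens it and prolongs the second one,
  -- until both start at r.
  Trail-diverge : ∀ {a b} → Trail r x (a ∷ xs) → Trail r x (b ∷ ys) → ¬ a ≢ b
  Trail-diverge (step x~a _ stop) tr a≢b =
    Trail-closed (step (symmetric T x~a) (λ b≡a → a≢b (sym (just-injective b≡a))) tr)
  Trail-diverge (step x~a nb tra@(step _ _ _)) tr a≢b =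
    Trail-diverge tra (step (symmetric T x~a) (λ b≡a → a≢b (sym (just-injective b≡a))) tr)
                  (λ c≡x → nb (cong just c≡x))

  module Rooted (_≟ᵥ_ : B.DecidableEquality V) (r : V)
                (connected : ∀ x → Star (Adj T) x r) where

    Trail-unique : Trail r x xs → Trail r x ys → xs ≡ ys
    Trail-unique stop               stop               = refl
    Trail-unique stop               tr@(step _ _ _)    = ⊥-elim (Trail-closed tr)
    Trail-unique tr@(step _ _ _)    stop               = ⊥-elim (Trail-closed tr)
    Trail-unique tr@(step {y = a} _ _ tra) tr′@(step {y = b} _ _ trb) with a ≟ᵥ b
    ... | yes refl = cong (a ∷_) (Trail-unique tra trb)
    ... | no a≢b   = ⊥-elim (Trail-diverge tr tr′ a≢b)

    -- If the trail from `y` continues to `x`, prepending the edge would turn back; the two opposite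
    -- steps then cancel.
    extend : Adj T x y → Trail r y ys → ∃ (Trail r x)
    extend x~y stop = _ , step x~y (λ ()) stop
    extend {x = x} x~y tr@(step {y = z} _ _ trz) with z ≟ᵥ x
    ... | yes refl = _ , trz
    ... | no z≢x   = _ , step x~y (z≢x ∘ just-injective) tr

    trailAlong : Star (Adj T) x r → ∃ (Trail r x)
    trailAlong ε           = [] , stop
    trailAlong (x~y ◅ y⋆r) = extend x~y (proj₂ (trailAlong y⋆r))

    -- The path from `x` to the root, without `x` itself; thus `up x ≡ y ∷ up y` says that `y` is
    -- the parent of `x`.
    up : V → List V
    up x = proj₁ (trailAlong (connected x))

    up-trail : ∀ x → Trail r x (up x)
    up-trail x = proj₂ (trailAlong (connected x))

    up-Trail : Trail r x xs → up x ≡ xs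
    up-Trail {x = x} = Trail-unique (up-trail x)

    -- If the path from `x` does not start with `y`, it can be prolonged to a trail from `y`, which
    -- by uniqueness is the path of `y`.
    up-adj : Adj T x y → up x ≡ y ∷ up y ⊎ up y ≡ x ∷ up x
    up-adj {x} {y} x~y with up x in eq | up-trail x
    ... | [] | tr = inj₂ (up-Trail (step (symmetric T x~y) (λ ()) tr))
    ... | z ∷ zs | tr@(step _ _ trz) with z ≟ᵥ y
    ...   | yes refl = inj₁ (cong (z ∷_) (sym (up-Trail trz)))
    ...   | no z≢y   = inj₂ (up-Trail (step (symmetric T x~y) (z≢y ∘ just-injective) tr))

    module _ {S : Pred V 0ℓ} (S? : Decidable S) where

      -- The last condition says that `t` has no parent in `S`: the walk towards the root stops
      -- there or just before leaving `S`.
      climb : Trail r x xs → S x → ∃[ t ] (S t × ∀ {y} → S y → up t ≢ y ∷ up y)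
      climb stop sx = r , sx , λ {y} _ eq → Trail-closed (subst (Trail r r) eq (up-trail r))
      climb {x = x} tr@(step {y = y} _ _ tr′) sx with S? y
      ... | yes sy = climb tr′ sy
      ... | no ¬sy = x , sx , λ sz eq →
        ¬sy (subst S (sym (List.∷-injectiveˡ (trans (sym (up-Trail tr)) eq))) sz)

      module _ (tree : IsTree (induced T S)) where
        private
          s₀ : Σ V S
          s₀ = IsTree.nonempty tree

          climbed : ∃[ t ] (S t × ∀ {y} → S y → up t ≢ y ∷ up y)
          climbed = climb (up-trail (proj₁ s₀)) (proj₂ s₀)

        top : V
        top = proj₁ climbed

        top∈ : S top
        top∈ = proj₁ (proj₂ climbed)

        -- Induction on a walk inside `S` from `x` to `top`. If the next vertex is the parent of
        -- `x`, then `x` is prepended to `ys`; if it is a child, its path loses its first vertex.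
        -- That child cannot be `top`, whose parent is not in `S`.
        up-above-top : S x → ∃[ ys ] (All S ys × x ∷ up x ≡ ys ++ top ∷ up top)
        up-above-top sx = descend (IsTree.connected tree (_ , sx) (top , top∈))
          where
          descend : ∀ {x} → Star (Adj (induced T S)) x (top , top∈) →
                    ∃[ ys ] (All S ys × proj₁ x ∷ up (proj₁ x) ≡ ys ++ top ∷ up top)
          descend ε = [] , [] , refl
          descend {x = x , sx} (_◅_ {j = y , sy} x~y y⋆t) with descend y⋆t | up-adj x~y
          ... | ys , sys , eq | inj₁ upx≡ = x ∷ ys , sx ∷ sys , cong (x ∷_) (trans upx≡ eq)
          ... | [] , _ , eq | inj₂ upy≡ with refl ← List.∷-injectiveˡ eq =
            contradiction upy≡ (proj₂ (proj₂ climbed) sx)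
          ... | _ ∷ ys , _ ∷ sys , eq | inj₂ upy≡ =
            ys , sys , trans (sym upy≡) (List.∷-injectiveʳ eq)

    -- The path from the common vertex to the root meets both tops. Up to the first of them it stays
    -- in both sets, so that top lies in both.
    tops-meet : {P Q : Pred V 0ℓ} (P? : Decidable P) (Q? : Decidable Q)
                (p : IsTree (induced T P)) (q : IsTree (induced T Q)) →
                P x → Q x → P (top Q? q) ⊎ Q (top P? p)
    tops-meet {P = P} {Q} P? Q? p q px qx
      with ys , pys , eq  ← up-above-top P? p px
         | zs , qzs , eq′ ← up-above-top Q? q qx =
        compare pys (top∈ P? p) qzs (top∈ Q? q) (trans (sym eq) eq′)
      where
      compare : ∀ {a b as bs ys zs} → All P ys → P a → All Q zs → Q b →
                ys ++ a ∷ as ≡ zs ++ b ∷ bs → P b ⊎ Q a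
      compare []        pa []        qb eq = inj₁ (subst P (List.∷-injectiveˡ eq) pa)
      compare []        pa (qz ∷ _)  qb eq = inj₂ (subst Q (sym (List.∷-injectiveˡ eq)) qz)
      compare (py ∷ _)  pa []        qb eq = inj₁ (subst P (List.∷-injectiveˡ eq) py)
      compare (_ ∷ pys) pa (_ ∷ qzs) qb eq = compare pys pa qzs qb (List.∷-injectiveʳ eq)

-- The degree sum of a graph of bounded tree-width

≤-foldr-⊔ : (f : Fin n → ℕ) → ∀ i → f i ≤ Vector.foldr _⊔_ 0 f
≤-foldr-⊔ f zero    = m≤m⊔n _ _
≤-foldr-⊔ f (suc i) = ≤-trans (≤-foldr-⊔ (f ∘ suc) i) (m≤n⊔m (f zero) _)

module _ {G : Graph (Fin n)} (D : TreeDecomposition G) where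
  open TreeDecomposition D hiding (width)
  open IsTree isTree using (nonempty; connected; acyclic)
  open Rooted {T = tree} acyclic _≟_ nonempty (λ i → connected i nonempty)

  bagTop : Fin n → Fin size
  bagTop v = top (λ i → v ∈? bag i) (bagsOfSubtree v)

  ∈bagTop : ∀ v → v ∈ bag (bagTop v)
  ∈bagTop v = top∈ (λ i → v ∈? bag i) (bagsOfSubtree v)

  -- Contains the out-neighbours of `v` in an orientation of `G` whose out-degrees are at most the
  -- width.
  back : Fin n → Subset n
  back v = bag (bagTop v) - v

  -- Removing `v`, which lies in its own top bag, accounts for the 1 subtracted in the width.
  ∣back∣≤width : ∀ v → ∣ back v ∣ ≤ width D
  ∣back∣≤width v = ∸-monoˡ-≤ {suc ∣ back v ∣} 1
    (≤-trans (x∈p⇒∣p-x∣<∣p∣ (∈bagTop v)) (≤-foldr-⊔ (∣_∣ ∘ bag) (bagTop v)))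

  adj⇒back : ∀ {u v} → Adj G u v → v ∈ back u ⊎ u ∈ back v
  adj⇒back {u} {v} u~v with i , u∈ , v∈ ← coversEdge u~v
    with tops-meet (λ i → u ∈? bag i) (λ i → v ∈? bag i) (bagsOfSubtree u) (bagsOfSubtree v) u∈ v∈
  ... | inj₁ u∈top = inj₂ (x∈p∧x≢y⇒x∈p-y u∈top (λ u≡v → loopless G u≡v u~v))
  ... | inj₂ v∈top = inj₁ (x∈p∧x≢y⇒x∈p-y v∈top (λ v≡u → loopless G (sym v≡u) u~v))

  -- Each neighbour of `v` lies in `back v` or has `v` in its own `back`. Summed over `v`, both
  -- kinds are bounded by the same number of pairs, at most `width D` for each vertex.
  degree-sum≤ : sum (degree G) ≤ 2 * (n * width D)
  degree-sum≤ = begin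
    sum (degree G)                                    ≤⟨ sum-mono degree≤ ⟩
    sum (λ v → ∣ ⟦ back? v ⟧ ∣ + ∣ ⟦ flip back? v ⟧ ∣)
      ≡⟨ ∑-distrib-+ (λ v → ∣ ⟦ back? v ⟧ ∣) (λ v → ∣ ⟦ flip back? v ⟧ ∣) ⟩
    sum (λ v → ∣ ⟦ back? v ⟧ ∣) + sum (λ v → ∣ ⟦ flip back? v ⟧ ∣)
      ≡⟨ cong (sum (λ v → ∣ ⟦ back? v ⟧ ∣) +_) (double-count back?) ⟨
    sum (λ v → ∣ ⟦ back? v ⟧ ∣) + sum (λ v → ∣ ⟦ back? v ⟧ ∣)
      ≤⟨ +-mono-≤ sum-back≤ (≤-trans sum-back≤ (m≤m+n _ 0)) ⟩
    2 * (n * width D)                                 ∎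
    where
    open ≤-Reasoning
    back? : B.Decidable (λ v u → u ∈ back v)
    back? v u = u ∈? back v
    degree≤ : ∀ v → degree G v ≤ ∣ ⟦ back? v ⟧ ∣ + ∣ ⟦ flip back? v ⟧ ∣
    degree≤ v = ≤-trans
      (p⊆q⇒∣p∣≤∣q∣ λ u∈N → x∈p∪q⁺ (case (adj⇒back (∈-⟦⟧⁻ (adj? G v) u∈N))))
      (∣p∪q∣≤∣p∣+∣q∣ ⟦ back? v ⟧ ⟦ flip back? v ⟧)
      where
      case : ∀ {u} → u ∈ back v ⊎ v ∈ back u → u ∈ ⟦ back? v ⟧ ⊎ u ∈ ⟦ flip back? v ⟧
      case (inj₁ u∈) = inj₁ (∈-⟦⟧⁺ (back? v) u∈)
      case (inj₂ v∈) = inj₂ (∈-⟦⟧⁺ (flip back? v) v∈)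
    sum-back≤ : sum (λ v → ∣ ⟦ back? v ⟧ ∣) ≤ n * width D
    sum-back≤ = sum-≤-const λ v →
      ≤-trans (p⊆q⇒∣p∣≤∣q∣ (∈-⟦⟧⁻ (back? v))) (∣back∣≤width v)

-- Graphs with a closed complement

n≤1+degrees : (G : Graph (Fin n)) → ∀ v → n ≤ suc (degree G v + degree (complement G) v)
n≤1+degrees {n} G v = begin
  n                                        ≡⟨ ∣⊤∣≡n n ⟨
  ∣ ⊤ {n} ∣                                ≤⟨ p⊆q⇒∣p∣≤∣q∣ {p = ⊤ {n}} (λ {u} _ → covers u) ⟩
  ∣ ⁅ v ⁆ ∪ (neighbours G v ∪ neighbours (complement G) v) ∣
    ≤⟨ ∣p∪q∣≤∣p∣+∣q∣ ⁅ v ⁆ _ ⟩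
  ∣ ⁅ v ⁆ ∣ + ∣ neighbours G v ∪ neighbours (complement G) v ∣
    ≤⟨ +-mono-≤ (≤-reflexive (∣⁅x⁆∣≡1 v)) (∣p∪q∣≤∣p∣+∣q∣ (neighbours G v) _) ⟩
  suc (degree G v + degree (complement G) v) ∎
  where
  open ≤-Reasoning
  covers : ∀ u → u ∈ ⁅ v ⁆ ∪ (neighbours G v ∪ neighbours (complement G) v)
  covers u with v ≟ u | adj? G v u
  ... | yes refl | _       = x∈p∪q⁺ (inj₁ (x∈⁅x⁆ v))
  ... | no _     | yes v~u = x∈p∪q⁺ (inj₂ (x∈p∪q⁺ (inj₁ (∈-⟦⟧⁺ (adj? G v) v~u))))
  ... | no v≢u   | no v≁u  =
    x∈p∪q⁺ (inj₂ (x∈p∪q⁺ (inj₂ (∈-⟦⟧⁺ (adj? (complement G) v) (v≢u , v≁u)))))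

IsVertexCover : Graph (Fin n) → Subset n → Set
IsVertexCover G S = ∀ {u v} → Adj G u v → u ∈ S ⊎ v ∈ S

module _ (G : Graph (Fin n)) (closed : BondyChvátalClosed (complement G)) where

  -- An edge of `G` is a non-edge of the complement, where closedness bounds the complement degrees.
  -- Its strict inequality absorbs one of the two units that `n≤1+degrees` contributes.
  adj⇒n≤1+degrees : ∀ {u v} → Adj G u v → n ≤ suc (degree G u + degree G v)
  adj⇒n≤1+degrees {u} {v} u~v = +-cancelʳ-≤ n _ _ (begin
    n + n                        ≤⟨ +-mono-≤ (n≤1+degrees G u) (n≤1+degrees G v) ⟩
    suc (a + a′) + suc (b + b′)  ≡⟨ interchange a a′ b b′ ⟩
    suc (a + b) + suc (a′ + b′)
      ≤⟨ +-monoʳ-≤ (suc (a + b))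
           (closed u v (λ u≡v → loopless G u≡v u~v) (λ (_ , u≁v) → u≁v u~v)) ⟩
    suc (a + b) + n              ∎)
    where
    open ≤-Reasoning
    a  = degree G u
    b  = degree G v
    a′ = degree (complement G) u
    b′ = degree (complement G) v
    interchange : ∀ a a′ b b′ → suc (a + a′) + suc (b + b′) ≡ suc (a + b) + suc (a′ + b′)
    interchange = solve-∀

  large? : Decidable (λ v → n ≤ suc (2 * degree G v))
  large? v = n ≤? suc (2 * degree G v)

  -- The endpoint of larger degree carries at least half of the degree sum of the edge.
  large-cover : IsVertexCover G ⟦ large? ⟧
  large-cover {u} {v} u~v with ≤-total (degree G u) (degree G v)
  ... | inj₁ u≤v = inj₂ (∈-⟦⟧⁺ large? (≤-trans (adj⇒n≤1+degrees u~v)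
          (s≤s (+-mono-≤ u≤v (m≤m+n _ 0)))))
  ... | inj₂ v≤u = inj₁ (∈-⟦⟧⁺ large? (≤-trans (adj⇒n≤1+degrees u~v)
          (s≤s (+-monoʳ-≤ _ (≤-trans v≤u (m≤m+n _ 0))))))

  few-large : (D : TreeDecomposition G) → ∣ ⟦ large? ⟧ ∣ ≤ 4 * width D ⊎ n ≤ suc (4 * width D)
  few-large D with ∣ ⟦ large? ⟧ ∣ ≤? 4 * width D
  ... | yes few = inj₁ few
  ... | no many = inj₂ (≤-trans (m≤n+m∸n n 1) (s≤s n-1≤4w))
    where
    open ≤-Reasoning
    w = width D
    expand : ∀ n w → 2 * (2 * (n * w)) ≡ n * (4 * w)
    expand = solve-∀
    n-1≤4w : n ∸ 1 ≤ 4 * w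
    -- Twice the degree sum lies between `suc (4 * w) * (n ∸ 1)` and `4 * w * n`; cancelling
    -- `4 * w * (n ∸ 1)` leaves the claim.
    n-1≤4w = +-cancelʳ-≤ (4 * w * (n ∸ 1)) _ _ (begin
      suc (4 * w) * (n ∸ 1)                    ≤⟨ *-monoˡ-≤ (n ∸ 1) (≰⇒> many) ⟩
      ∣ ⟦ large? ⟧ ∣ * (n ∸ 1)                 ≤⟨ ∣p∣*c≤sum ⟦ large? ⟧ (∸-monoˡ-≤ 1 ∘ ∈-⟦⟧⁻ large?) ⟩
      sum (λ v → degree G v + (degree G v + 0)) ≡⟨ ∑-distrib-+ (degree G) _ ⟩
      sum (degree G) + sum (λ v → degree G v + 0)
        ≡⟨ cong (sum (degree G) +_) (sum-cong-≗ (λ v → +-identityʳ (degree G v))) ⟩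
      sum (degree G) + sum (degree G)
        ≤⟨ +-mono-≤ (degree-sum≤ D) (≤-trans (degree-sum≤ D) (m≤m+n _ 0)) ⟩
      2 * (2 * (n * w))                        ≡⟨ expand n w ⟩
      -- The bound `n ≤ 1 + (n ∸ 1)` also covers `n = 0`, where the subtraction is truncated.
      n * (4 * w)                              ≤⟨ *-monoˡ-≤ (4 * w) (m≤n+m∸n n 1) ⟩
      suc (n ∸ 1) * (4 * w)                    ≡⟨ cong (4 * w +_) (*-comm (n ∸ 1) (4 * w)) ⟩
      4 * w + 4 * w * (n ∸ 1)                  ∎)

-- Twins

-- The pointwise form of `SameType`, in which transitivity and the passage to the complement can be
-- checked vertex by vertex.
Twin : Graph (Fin n) → Rel (Fin n) 0ℓ
Twin H u v = ∀ {x} → x ≢ u → x ≢ v → Adj H x u ⇔ Adj H x v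

SameType : Graph (Fin n) → Rel (Fin n) 0ℓ
SameType H u v = neighbours H u - v ≡ neighbours H v - u

module _ (H : Graph (Fin n)) where

  Twin-sym : ∀ {u v} → Twin H u v → Twin H v u
  Twin-sym uv x≢v x≢u = mk⇔ from to
    where open Equivalence (uv x≢u x≢v)

  Twin-trans : ∀ {u v t} → Twin H u v → Twin H v t → Twin H u t
  Twin-trans uv vt x≢u x≢t = mk⇔ (half uv vt x≢u x≢t) (half (Twin-sym vt) (Twin-sym uv) x≢t x≢u)
    where
    half : ∀ {u v t x} → Twin H u v → Twin H v t → x ≢ u → x ≢ t → Adj H x u → Adj H x t
    half {u} {v} {t} {x} uv vt x≢u x≢t x~u with x ≟ v
    ... | no x≢v = Equivalence.to (vt x≢v x≢t) (Equivalence.to (uv x≢u x≢v) x~u)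
    -- At the middle vertex neither hypothesis applies directly: from `u` adjacent to `v`, the
    -- second one makes `u` adjacent to `t`, and then the first makes `t` adjacent to `v`.
    ... | yes refl with u ≟ t
    ...   | yes refl = x~u
    ...   | no u≢t = symmetric H (Equivalence.to (uv (u≢t ∘ sym) (x≢t ∘ sym))
                       (symmetric H (Equivalence.to (vt (x≢u ∘ sym) u≢t) (symmetric H x~u))))

  Twin⇒SameType : ∀ {u v} → Twin H u v → SameType H u v
  Twin⇒SameType uv = ⊆-antisym (half uv) (half (Twin-sym uv))
    where
    half : ∀ {u v} → Twin H u v → neighbours H u - v ⊆ neighbours H v - u
    half {u} {v} uv {x} x∈ = x∈p∧x≢y⇒x∈p-y
      (∈-⟦⟧⁺ (adj? H v) (symmetric H (Equivalence.to (uv x≢u x≢v) (symmetric H u~x)))) x≢u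
      where
      u~x : Adj H u x
      u~x = ∈-⟦⟧⁻ (adj? H u) (p─q⊆p _ _ x∈)
      x≢u : x ≢ u
      x≢u x≡u = loopless H (sym x≡u) u~x
      x≢v : x ≢ v
      x≢v refl = x∉p-x {p = neighbours H u} x∈

  SameType⇒Twin : ∀ {u v} → SameType H u v → Twin H u v
  SameType⇒Twin uv x≢u x≢v = mk⇔ (half uv x≢v) (half (sym uv) x≢u)
    where
    half : ∀ {u v x} → SameType H u v → x ≢ v → Adj H x u → Adj H x v
    half {u} {v} uv x≢v x~u = symmetric H (∈-⟦⟧⁻ (adj? H v) (p─q⊆p _ _
      (subst (_ ∈_) uv (x∈p∧x≢y⇒x∈p-y (∈-⟦⟧⁺ (adj? H u) (symmetric H x~u)) x≢v))))

  SameType-isEquivalence : IsEquivalence (SameType H)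
  SameType-isEquivalence = record
    { refl  = refl
    ; sym   = sym
    ; trans = λ uv vt → Twin⇒SameType (Twin-trans (SameType⇒Twin uv) (SameType⇒Twin vt))
    }

  SameType? : B.Decidable (SameType H)
  SameType? u v = ≡-dec _≟ᵇ_ _ _

Twin-complement : (G : Graph (Fin n)) → ∀ {u v} → Twin G u v → Twin (complement G) u v
Twin-complement G uv x≢u x≢v = mk⇔ (λ (_ , x≁u) → x≢v , x≁u ∘ from) (λ (_ , x≁v) → x≢u , x≁v ∘ to)
  where open Equivalence (uv x≢u x≢v)

-- Coding vertices by means of a vertex cover

bit : ∀ {a} {A : Set a} → Dec A → Fin 2
bit (yes _) = suc zero
bit (no _)  = zero

bit-≡ : ∀ {a b} {A : Set a} {B : Set b} (A? : Dec A) (B? : Dec B) → bit A? ≡ bit B? → A → B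
bit-≡ _       (yes b) _  _ = b
bit-≡ (yes _) (no _)  () _
bit-≡ (no ¬a) (no _)  _  a = contradiction a ¬a

module _ (G : Graph (Fin n)) (S : Subset n) (cover : IsVertexCover G S) where

  trace : Fin n → Fin (2 ^ ∣ S ∣)
  trace v = funToFin λ i → bit (adj? G (enumerate S i) v)

  trace-adj : ∀ {u v x} → trace u ≡ trace v → x ∈ S → Adj G x u → Adj G x v
  trace-adj {u} {v} eq x∈ with i , refl ← index x∈ = bit-≡ (adj? G _ u) (adj? G _ v)
    (trans (sym (finToFun-funToFin _ i))
      (trans (cong (λ c → finToFun c i) eq) (finToFun-funToFin _ i)))

  -- The decision is an argument so that `code-twin` can split on it for two vertices at once.
  code : ∀ {v} → Dec (v ∈ S) → Fin (2 ^ ∣ S ∣) ⊎ Fin ∣ S ∣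
  code     (yes v∈) = inj₂ (proj₁ (index v∈))
  code {v} (no _)   = inj₁ (trace v)

  -- A vertex outside the cover `S` has all its neighbours in `S`, so its trace determines its
  -- neighbourhood. A vertex of `S` is determined by its position.
  code-twin : ∀ {u v} (u? : Dec (u ∈ S)) (v? : Dec (v ∈ S)) → code u? ≡ code v? → Twin G u v
  code-twin (yes u∈) (yes v∈) eq with index u∈ | index v∈ | inj₂-injective eq
  ... | _ , refl | _ , refl | refl = λ _ _ → mk⇔ id id
  code-twin {u} {v} (no u∉) (no v∉) eq _ _ =
    mk⇔ (half (inj₁-injective eq) u∉) (half (sym (inj₁-injective eq)) v∉)
    where
    half : ∀ {u v x} → trace u ≡ trace v → u ∉ S → Adj G x u → Adj G x v
    half eq u∉ x~u with cover x~u
    ... | inj₁ x∈ = trace-adj eq x∈ x~u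
    ... | inj₂ u∈ = contradiction u∈ u∉
  code-twin (yes _) (no _)  ()
  code-twin (no _)  (yes _) ()

-- Quotients of finite sets

-- Encoded by a system of representatives; `distinct` rules out two of them in one class, so `size`
-- is the exact number of classes.
record Quotient (R : Rel (Fin n) 0ℓ) : Set where
  field
    size     : ℕ
    class    : Fin n → Fin size
    rep      : Fin size → Fin n
    sound    : ∀ x → R x (rep (class x))
    distinct : ∀ {i j} → R (rep i) (rep j) → i ≡ j

  -- By `distinct`, such an `f` is injective on the representatives.
  size≤ : (f : Fin n → Fin m) → (∀ {x y} → f x ≡ f y → R x y) → size ≤ m
  size≤ f sep = injective⇒≤ (λ eq → distinct (sep eq))

-- Induction on `n`: the new element joins the class of an earlier representative or represents a
-- new class.
quotient : {R : Rel (Fin n) 0ℓ} → IsEquivalence R → B.Decidable R → Quotient R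
quotient {n = zero} _ _ = record
  { size = 0 ; class = λ () ; rep = λ () ; sound = λ () ; distinct = λ { {()} } }
quotient {n = suc n} {R} isEq R? with quotient {R = λ x y → R (suc x) (suc y)}
  (record { refl = R.refl ; sym = R.sym ; trans = R.trans }) (λ x y → R? (suc x) (suc y))
  where module R = IsEquivalence isEq
... | Q with any? (λ j → R? zero (suc (Quotient.rep Q j)))
...   | yes (j , 0Rj) = record
  { class    = λ { zero → j ; (suc x) → class x }
  ; rep      = suc ∘ rep
  ; sound    = λ { zero → 0Rj ; (suc x) → sound x }
  ; distinct = distinct
  }
  where open Quotient Q
...   | no ¬0Rj = record
  { class    = λ { zero → zero ; (suc x) → suc (class x) }
  ; rep      = λ { zero → zero ; (suc j) → suc (rep j) }
  ; sound    = λ { zero → IsEquivalence.refl isEq ; (suc x) → sound x }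
  ; distinct = λ
    { {zero}  {zero}  _   → refl
    ; {zero}  {suc j} 0Rj → contradiction (j , 0Rj) ¬0Rj
    ; {suc j} {zero}  jR0 → contradiction (j , IsEquivalence.sym isEq jR0) ¬0Rj
    ; {suc i} {suc j} iRj → cong suc (distinct iRj)
    }
  }
  where open Quotient Q

-- Neighborhood diversity as the number of type classes

module _ {H : Graph (Fin n)} (Q : Quotient (SameType H)) where
  open Quotient Q
  open IsEquivalence (SameType-isEquivalence H) renaming (sym to ≈-sym; trans to ≈-trans)

  quotientPartition : TypePartition H size
  quotientPartition = record
    { class      = class
    ; surjective = λ i → rep i , distinct (≈-sym {rep i} (sound (rep i)))
    ; sameType   = λ u v eq → ≈-trans {u} (sound u)
        (≈-sym {v} (subst (SameType H v ∘ rep) (sym eq) (sound v)))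
    }

  -- The class map of any competing partition separates types, so `size≤` gives minimality.
  quotient-diversity : HasNeighbourhoodDiversity H size
  quotient-diversity = quotientPartition , λ j P →
    size≤ (TypePartition.class P) (TypePartition.sameType P _ _)

theorem2 : ∀ (n w : ℕ) (G : Graph (Fin n)) →
    HasTreeWidth G w →
    BondyChvátalClosed (complement G) →
    let k = 2 * (w ^ 2 + w) in
    ∃[ d ] (HasNeighbourhoodDiversity (complement G) d × d ≤ 2 ^ k + k)
theorem2 n w G ((D , refl) , _) closed = size , quotient-diversity Q , bound
  where
  H = complement G
  k = 2 * (w ^ 2 + w)
  Q = quotient (SameType-isEquivalence H) (SameType? H)
  open Quotient Q

  4w≤k : 4 * w ≤ k
  4w≤k = ≤-trans (≤-reflexive (*-assoc 2 2 w))
    (*-monoʳ-≤ 2 (+-mono-≤ (w≤w^2 w) (≤-reflexive (+-identityʳ w))))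
    where
    w≤w^2 : ∀ w → w ≤ w ^ 2
    w≤w^2 zero      = z≤n
    w≤w^2 w@(suc _) = m≤m*n w (w * 1)

  bound : size ≤ 2 ^ k + k
  bound with few-large G closed D
  -- Here counting vertices suffices: `n ≤ 1 + 4 * w`, with `1 ≤ 2 ^ k` and `4 * w ≤ k`.
  ... | inj₂ n≤ = ≤-trans (size≤ id λ { refl → refl }) (≤-trans n≤ (+-mono-≤ (m^n>0 2 k) 4w≤k))
  ... | inj₁ S≤ = ≤-trans (size≤ f f-sep) (+-mono-≤ (^-monoʳ-≤ 2 S≤k) S≤k)
    where
    S = ⟦ large? G closed ⟧
    S≤k : ∣ S ∣ ≤ k
    S≤k = ≤-trans S≤ 4w≤k
    f : Fin n → Fin (2 ^ ∣ S ∣ + ∣ S ∣)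
    f v = join _ _ (code G S (large-cover G closed) (v ∈? S))
    f-sep : ∀ {u v} → f u ≡ f v → SameType H u v
    f-sep {u} {v} eq = Twin⇒SameType H (Twin-complement G
      (code-twin G S (large-cover G closed) (u ∈? S) (v ∈? S)
        (trans (sym (splitAt-join _ _ _))
          (trans (cong (splitAt (2 ^ ∣ S ∣)) eq) (splitAt-join _ _ _)))))
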